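{- (M-PAIR) The following type is inhabited: $$\prod_{a:M}\ \prod_{b:M}\ \sum_{c:M}\ \prod_{z:M}\ \Bigl(z\in c\;\simeq\;\bigl(z=_M a\;\vee\;z=_M b\bigr)\Bigr).$$
   Context: The setting is Martin-Löf (homotopy/univalent) type theory with the Univalence Axiom (hence function extensionality); $A:\mathrm{Set}$ means "$A$ is a type" (not necessarily a 0-type), $A\simeq B$ is the type of equivalences as in the Homotopy Type Theory book, and $\vee$ denotes the (untruncated) disjoint sum type $+$ (propositions-as-types). $U:\mathrm{Set}$ is a univalent universe with decoding function $T:U\to\mathrm{Set}$; univalent means that for $a,b:U$ the canonical map $\mathrm{Id}_U\,a\,b\to (T\,a\simeq T\,b)$ is an equivalence. $U$ is assumed closed under $+$, $\Sigma$-, $\Pi$- and identity types, and to contain codes for the unit type $1$ and the two-element type $2=1+1$. $M := W_{a:U}\,T\,a$ is the W-type with canonical elements $\sup\,a\,f$, where $a:U$ and $f:T\,a\to M$. The relation $=_M\,:M\to M\to\mathrm{Set}$ is defined by recursion: $$(\sup\,a\,f)=_M(\sup\,b\,g)\;:=\;\sum_{\alpha:T a\simeq T b}\ \prod_{x:T a}\ (f\,x)=_M\bigl(g\,(\alpha\,x)\bigr).$$ The relation $\in\,:M\to M\to\mathrm{Set}$ is defined by $$x\in(\sup\,b\,g)\;:=\;\sum_{i:T b}\ x=_M(g\,i).$$ -}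

{-# OPTIONS --without-K #-}

module Defs where

open import Data.Container.Core using (Container; _▷_)
open import Data.Product using (Σ-syntax; _,_)
open import Data.Sum using (_⊎_)
open import Data.Unit.Polymorphic using (⊤)
open import Data.W using (W; sup)
open import Function.Base using (id)
open import Function.Properties.Inverse.HalfAdjointEquivalence public using (_≃_)
open import Level using (Level; suc; _⊔_)
open import Relation.Binary.PropositionalEquality using (_≡_; refl; cong)

private
  variable
    a b : Level

-- The type A ≃ B amounts to Σ f ∶ A → B , IsEquiv f.
IsEquiv : {A : Set a} {B : Set b} → (A → B) → Set (a ⊔ b)
IsEquiv {A = A} {B = B} f =
  Σ[ g ∈ (B → A) ]
  Σ[ η ∈ (∀ x → g (f x) ≡ x) ]
  Σ[ ε ∈ (∀ y → f (g y) ≡ y) ]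
  (∀ x → cong f (η x) ≡ ε (f x))

id≃ : {A : Set a} → A ≃ A
id≃ = record
  { to               = id
  ; from             = id
  ; left-inverse-of  = λ _ → refl
  ; right-inverse-of = λ _ → refl
  ; left-right       = λ _ → refl
  }

transport≃ : {A : Set a} (B : A → Set b) {x y : A} → x ≡ y → B x ≃ B y
transport≃ B refl = id≃

IsUnivalent : {A : Set a} → (A → Set b) → Set (a ⊔ b)
IsUnivalent {A = A} B = (x y : A) → IsEquiv (transport≃ B {x} {y})

Univalence : (ℓ : Level) → Set (suc ℓ)
Univalence ℓ = IsUnivalent {A = Set ℓ} id

-- Set ℓ plays the role of the ambient universe of types. Decoding is required
-- to commute with the type formers only up to ≃, which is weaker than the
-- judgmental equalities of a universe à la Tarski.
record UnivalentUniverse (ℓ : Level) : Set (suc ℓ) where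
  field
    U          : Set ℓ
    T          : U → Set ℓ
    univalent  : IsUnivalent T
    +-closed   : (a b : U) → Σ[ c ∈ U ] T c ≃ (T a ⊎ T b)
    Σ-closed   : (a : U) (b : T a → U) → Σ[ c ∈ U ] T c ≃ (Σ[ x ∈ T a ] T (b x))
    Π-closed   : (a : U) (b : T a → U) → Σ[ c ∈ U ] T c ≃ ((x : T a) → T (b x))
    Id-closed  : (a : U) (x y : T a) → Σ[ c ∈ U ] T c ≃ (x ≡ y)
    one        : Σ[ c ∈ U ] T c ≃ ⊤ {ℓ}
    two        : Σ[ c ∈ U ] T c ≃ (⊤ {ℓ} ⊎ ⊤ {ℓ})

module MultisetModel {ℓ : Level} (𝒰 : UnivalentUniverse ℓ) where
  open UnivalentUniverse 𝒰

  M : Set ℓ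
  M = W (U ▷ T)

  infix 4 _=M_ _∈_

  _=M_ : M → M → Set ℓ
  sup (a , f) =M sup (b , g) =
    Σ[ α ∈ T a ≃ T b ] ((x : T a) → f x =M g (_≃_.to α x))

  _∈_ : M → M → Set ℓ
  x ∈ sup (b , g) = Σ[ i ∈ T b ] x =M g i

{-# OPTIONS --safe #-}
{-# OPTIONS --without-K #-}
module Submission where

-- The pair of a and b is the multiset indexed by the code of the two-element
-- type, with a at one index and b at the other. Membership of z in it is a sum
-- over that index type. Along the decoding equivalence this sum becomes one
-- over 1 + 1 (Σ-↔), and a sum over 1 + 1 is the disjoint sum of its two fibres
-- (Σ-⊤⊎⊤↔⊎), here z =M a and z =M b. Nothing is used about =M beyond its being
-- a type family.

open import Data.Product using (Σ; Σ-syntax; _,_)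
open import Data.Product.Function.Dependent.Propositional using (Σ-↔)
open import Data.Sum using (_⊎_; inj₁; inj₂; [_,_]; [_,_]′)
open import Data.Unit.Polymorphic using (⊤)
open import Data.W using (sup)
open import Function.Base using (const)
open import Function.Bundles using (_↔_; mk↔ₛ′)
open import Function.Properties.Inverse using (↔-refl; ↔-trans)
open import Function.Properties.Inverse.HalfAdjointEquivalence using (↔⇒≃; ≃⇒↔)
open import Level using (Level)
open import Relation.Binary.PropositionalEquality using (refl)
open import Defs

Σ-⊤⊎⊤↔⊎ : {i j p : Level} (P : ⊤ {i} ⊎ ⊤ {j} → Set p) →
          Σ (⊤ ⊎ ⊤) P ↔ (P (inj₁ _) ⊎ P (inj₂ _))
Σ-⊤⊎⊤↔⊎ P = mk↔ₛ′
  (λ { (inj₁ _ , p) → inj₁ p ; (inj₂ _ , p) → inj₂ p })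
  [ (inj₁ _ ,_) , (inj₂ _ ,_) ]
  (λ { (inj₁ _) → refl ; (inj₂ _) → refl })
  (λ { (inj₁ _ , _) → refl ; (inj₂ _ , _) → refl })

module _ {ℓ : Level} (𝒰 : UnivalentUniverse ℓ) where
  open UnivalentUniverse 𝒰
  open MultisetModel 𝒰

  -- The unordered pair of two multisets. When a and b are equal, the element
  -- has multiplicity two, so that membership is an untruncated disjoint sum.
  pair : M → M → M
  pair a b = let (c , e) = two in
    sup (c , λ i → [ const a , const b ]′ (_≃_.to e i))

  ∈-pair : (a b z : M) → (z ∈ pair a b) ≃ ((z =M a) ⊎ (z =M b))
  ∈-pair a b z = let (c , e) = two in
    ↔⇒≃ (↔-trans
      (Σ-↔ (≃⇒↔ e) ↔-refl)
      (Σ-⊤⊎⊤↔⊎ (λ s → z =M [ const a , const b ]′ s)))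

proposition4 : {ℓ : Level} → Univalence ℓ → (𝒰 : UnivalentUniverse ℓ) →
    let open MultisetModel 𝒰 in
    (a b : M) → Σ[ c ∈ M ] ((z : M) → (z ∈ c) ≃ ((z =M a) ⊎ (z =M b)))
proposition4 _ 𝒰 a b = pair 𝒰 a b , ∈-pair 𝒰 a b
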